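{- Let $\Delta,k$ be integers with $k\ge 1$ odd and $\Delta\ge 4k+1$. Then there is a gadget $G_{\Delta,k}$, i.e. a realizable instance of $\Delta$-$k$-DiTTR (so that $D_{u,v}\ge\hat d(u,v)+k$ for all $u,v$), that enforces $\lambda(v_1,v_2)=\lambda(v_2,v_1)$ for some pair of adjacent vertices $(v_1,v_2)$. Moreover, for any even $k$ with $\Delta\ge 4k+5$, the gadget $G_{\Delta,k+1}$ for $k+1$ is also such a gadget for slack $k$, i.e. a realizable instance of $\Delta$-$k$-DiTTR enforcing $\lambda(v_1,v_2)=\lambda(v_2,v_1)$ for some pair of adjacent vertices.
   Context: All graphs are finite. A $\Delta$-periodic labeling of a directed graph $G=(V,E)$ is a map $\lambda:E\to\{0,1,\dots,\Delta-1\}$; edge $e$ is then active exactly at the times $\lambda(e)+i\Delta$, $i\in\mathbb{N}_0$. A temporal $s$-$z$-path is a sequence $(v_{i-1},v_i,t_i)_{i=1}^{\ell}$ with $v_0=s$, $v_\ell=z$, pairwise distinct vertices $v_0,\dots,v_\ell$, $(v_{i-1},v_i)\in E$ active at time $t_i$ for every $i$, and $t_1<t_2<\dots<t_\ell$ (strictly increasing). Its duration is $t_\ell+1-t_1$. A fastest temporal path is one of minimum duration. $\hat d(u,v)$ is the distance from $u$ to $v$ in the static graph $G$ (all edges have unit length). A bidirected tree is the directed graph obtained from an undirected tree by replacing each edge $\{u,v\}$ by the two directed edges $(u,v),(v,u)$ (which may get different labels). For integers $\Delta\ge1,k\ge0$, an instance of $\Delta$-$k$-DiTTR consists of a bidirected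 tree $G=(V,E)$ and a matrix $D$ indexed by $V\times V$ with entries positive integers or $\infty$ (no restriction) such that $D_{u,v}\ge\hat d(u,v)+k$ for all $u,v$. A valid labeling is a $\Delta$-periodic labeling $\lambda$ of $E$ such that, for all $u,v\in V$, the duration of a fastest temporal path from $u$ to $v$ is at most $D_{u,v}$; the instance is realizable if a valid labeling exists. Diagonal entries of $D$ play no role; all conditions on $D$ are for distinct vertices. An instance enforces $\lambda(v_1,v_2)=\lambda(v_2,v_1)$ if this equality holds for every valid labeling $\lambda$. -}

module Defs where

open import Data.Fin using (Fin; toℕ)
open import Data.List using (List; []; _∷_; length)
open import Data.List.Relation.Unary.Unique.Propositional using (Unique)
open import Data.Nat using (ℕ; suc; _+_; _*_; _∸_; _≤_; _<_)
open import Data.Product using (Σ-syntax; ∃; ∃-syntax; ∃₂; _×_; _,_)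
open import Function using (_↔_)
open import Level using (0ℓ)
open import Relation.Binary using
  (Rel; Symmetric; Irreflexive; Irrelevant; Decidable)
open import Relation.Binary.Construct.Add.Supremum.NonStrict _≤_ using (_≤⁺_)
open import Relation.Binary.Construct.Closure.ReflexiveTransitive
  using (Star; ε; _◅_)
open import Relation.Binary.PropositionalEquality using (_≡_; _≢_)
open import Relation.Nullary using (¬_)
open import Relation.Nullary.Construct.Add.Supremum using (_⁺; [_])

-- `Irrelevant E` excludes parallel edges: E is a set of ordered pairs.
record Digraph : Set₁ where
  field
    V      : Set
    finite : ∃[ n ] (V ↔ Fin n)
    E      : Rel V 0ℓ
    E?     : Decidable E
    E-irr  : Irrelevant E

  Edge : Set
  Edge = ∃₂ E

  Walk : Rel V 0ℓ
  Walk = Star E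

  vertices : ∀ {u v} → Walk u v → List V
  vertices {u} ε        = u ∷ []
  vertices {u} (_ ◅ w) = u ∷ vertices w

  walkLength : ∀ {u v} → Walk u v → ℕ
  walkLength ε       = 0
  walkLength (_ ◅ w) = suc (walkLength w)

  record Path (u v : V) : Set where
    field
      walk     : Walk u v
      distinct : Unique (vertices walk)

    pathLength : ℕ
    pathLength = walkLength walk

  open Path public using (pathLength)

  IsDistance : V → V → ℕ → Set
  IsDistance u v d =
    (Σ[ p ∈ Path u v ] pathLength p ≡ d) × (∀ (p : Path u v) → d ≤ pathLength p)

-- A finite simple undirected graph, given by its adjacency relation.  The same
-- relation is the edge set of the bidirected graph, in which (u , v) and (v , u)
-- are two different edges.
record Graph : Set₁ where
  field
    bidirected : Digraph
  open Digraph bidirected public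
  field
    symmetric   : Symmetric E
    irreflexive : Irreflexive _≡_ E

record IsTree (G : Graph) : Set where
  open Graph G
  field
    connected : ∀ u v → Walk u v
    -- A path of length at least two cannot be closed up to a cycle.
    acyclic   : ∀ {u v} (p : Path u v) → 2 ≤ pathLength p → ¬ E v u

Labeling : ℕ → Digraph → Set
Labeling Δ G = Digraph.Edge G → Fin Δ

module Temporal {Δ : ℕ} (G : Digraph) (lab : Labeling Δ G) where
  open Digraph G

  ActiveAt : Edge → ℕ → Set
  ActiveAt e t = ∃[ i ] t ≡ toℕ (lab e) + i * Δ

  -- TemporalWalk s t₁ z tₗ: at least one edge, first edge taken at time t₁ and
  -- last edge taken at time tₗ.
  data TemporalWalk : V → ℕ → V → ℕ → Set where
    last : ∀ {u v t} (e : E u v) → ActiveAt (u , v , e) t → TemporalWalk u t v t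
    step : ∀ {u v z t t′ tₗ} (e : E u v) → ActiveAt (u , v , e) t → t < t′ →
           TemporalWalk v t′ z tₗ → TemporalWalk u t z tₗ

  temporalVertices : ∀ {s t₁ z tₗ} → TemporalWalk s t₁ z tₗ → List V
  temporalVertices (last {u} {v} _ _)   = u ∷ v ∷ []
  temporalVertices (step {u} _ _ _ w) = u ∷ temporalVertices w

  record TemporalPath (s z : V) : Set where
    field
      t₁ tₗ    : ℕ
      walk     : TemporalWalk s t₁ z tₗ
      distinct : Unique (temporalVertices walk)

    duration : ℕ
    duration = (tₗ + 1) ∸ t₁

  open TemporalPath public using (duration)

  IsFastest : ∀ {s z} → TemporalPath s z → Set
  IsFastest {s} {z} p = ∀ (q : TemporalPath s z) → duration p ≤ duration q

-- A bidirected tree with a matrix of positive integers or ∞ (`⊤⁺`).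
record TreeWithBounds : Set₁ where
  field
    tree   : Graph
    isTree : IsTree tree
  open Graph tree public
  field
    D          : V → V → ℕ ⁺
    D-positive : ∀ u v → [ 1 ] ≤⁺ D u v

module _ (I : TreeWithBounds) where
  open TreeWithBounds I

  -- The condition for I to be an instance of Δ-k-DiTTR; it does not involve Δ.
  HasSlack : ℕ → Set
  HasSlack k =
    ∀ u v → u ≢ v → ∃[ d ] IsDistance u v d × [ d + k ] ≤⁺ D u v

  Valid : ∀ {Δ} → Labeling Δ bidirected → Set
  Valid lab =
    ∀ u v → u ≢ v → Σ[ p ∈ TemporalPath u v ] IsFastest p × [ duration p ] ≤⁺ D u v
    where open Temporal bidirected lab

  Realizable : ℕ → Set
  Realizable Δ = Σ[ lab ∈ Labeling Δ bidirected ] Valid lab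

  EnforcesEqual : ℕ → ∀ {v₁ v₂} → E v₁ v₂ → Set
  EnforcesEqual Δ {v₁} {v₂} e =
    ∀ (lab : Labeling Δ bidirected) → Valid lab →
    lab (v₁ , v₂ , e) ≡ lab (v₂ , v₁ , symmetric e)

record IsGadget (Δ k : ℕ) (I : TreeWithBounds) : Set where
  open TreeWithBounds I
  field
    hasSlack   : HasSlack I k
    realizable : Realizable I Δ
    enforces   : ∃[ v₁ ] ∃[ v₂ ] Σ[ e ∈ E v₁ v₂ ] EnforcesEqual I Δ e

{-# OPTIONS --safe #-}
-- The gadget is a path with layers 0, …, n = k + 2 whose two ends are doubled:
-- twins x, y in layer 0 and w, z in layer n.  All bounds are distance plus k.  A
-- walk from x to y or from w to z spends e, e′ ≤ k beyond the minimum duration 2,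
-- a walk from x to z or from w to y spends δ, δ′ ≤ k beyond n.  The walks x→y and
-- x→z start on the same edge, x→y and w→y end on the same edge, and likewise at
-- w and z; summing up, e + e′ ≡ 2k + δ + δ′ modulo Δ.  As 4k < Δ this is an
-- equality, so δ = δ′ = 0: the long walks from x and w never wait, and they start
-- at congruent times.  For odd k they traverse the middle edge, in opposite
-- directions, after the same number of steps.  Conversely, labelling an edge by
-- the distance of its source from the end it leads away from is valid.
module Submission where

open import Defs
open import Data.Fin using (Fin; toℕ; fromℕ<)
import Data.Fin as Fin
open import Data.Fin.Properties
  using (toℕ<n; toℕ-fromℕ<; toℕ-fromℕ; toℕ-injective; toℕ-inject₁; fromℕ≢inject₁)
open import Data.List using ([]; _∷_)
open import Data.List.Relation.Unary.All as All using (All; []; _∷_)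
open import Data.List.Relation.Unary.AllPairs using ([]; _∷_)
open import Data.List.Relation.Unary.Any using (Any; here; there)
open import Data.List.Relation.Unary.Unique.Propositional using (Unique)
open import Data.Nat
open import Data.Nat.Divisibility using (_∣_; _∤_; ∣m+n∣m⇒∣n; ∣1⇒≡1; m%n≡0⇒n∣m)
open import Data.Nat.DivMod
open import Data.Nat.Properties
open import Data.Nat.Tactic.RingSolver using (solve-∀)
open import Data.Product
  using (Σ-syntax; ∃-syntax; _×_; _,_; proj₁; proj₂)
open import Data.Sum as Sum using (_⊎_; inj₁; inj₂)
open import Function using (_∘_)
open import Function.Properties.Inverse using (↔-refl)
open import Relation.Binary.Construct.Add.Supremum.NonStrict _≤_
  using ([_]; [≤]-injective)
open import Relation.Binary.Construct.Closure.ReflexiveTransitive using (ε; _◅_)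
open import Relation.Binary.Definitions using (tri<; tri≈; tri>)
open import Relation.Binary.PropositionalEquality
import Relation.Nullary.Construct.Add.Supremum as Supremum
open import Relation.Nullary using (¬_; yes; no; contradiction)

∣m-n∣≡1⇒n≡1+m∨m≡1+n : ∀ m n → ∣ m - n ∣ ≡ 1 → n ≡ suc m ⊎ m ≡ suc n
∣m-n∣≡1⇒n≡1+m∨m≡1+n zero    n       eq = inj₁ eq
∣m-n∣≡1⇒n≡1+m∨m≡1+n (suc m) zero    eq = inj₂ eq
∣m-n∣≡1⇒n≡1+m∨m≡1+n (suc m) (suc n) eq =
  Sum.map (cong suc) (cong suc) (∣m-n∣≡1⇒n≡1+m∨m≡1+n m n eq)

∣m-1+m∣≡1 : ∀ m → ∣ m - suc m ∣ ≡ 1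
∣m-1+m∣≡1 zero    = refl
∣m-1+m∣≡1 (suc m) = ∣m-1+m∣≡1 m

[o∸m]∸[o∸n]≡n∸m : ∀ m {n o} → n ≤ o → (o ∸ m) ∸ (o ∸ n) ≡ n ∸ m
[o∸m]∸[o∸n]≡n∸m m {n} {o} n≤o = begin
  (o ∸ m) ∸ (o ∸ n)  ≡⟨ ∸-+-assoc o m (o ∸ n) ⟩
  o ∸ (m + (o ∸ n))  ≡⟨ cong (o ∸_) (+-comm m (o ∸ n)) ⟩
  o ∸ ((o ∸ n) + m)  ≡⟨ ∸-+-assoc o (o ∸ n) m ⟨
  o ∸ (o ∸ n) ∸ m    ≡⟨ cong (_∸ m) (m∸[m∸n]≡n n≤o) ⟩
  n ∸ m              ∎
  where open ≡-Reasoning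

∣o∸m-o∸n∣≡∣m-n∣ : ∀ {m n o} → m ≤ o → n ≤ o → ∣ (o ∸ m) - (o ∸ n) ∣ ≡ ∣ m - n ∣
∣o∸m-o∸n∣≡∣m-n∣ {m} {n} {o} m≤o n≤o with ≤-total m n
... | inj₁ m≤n = begin
  ∣ (o ∸ m) - (o ∸ n) ∣  ≡⟨ m≤n⇒∣n-m∣≡n∸m (∸-monoʳ-≤ o m≤n) ⟩
  (o ∸ m) ∸ (o ∸ n)      ≡⟨ [o∸m]∸[o∸n]≡n∸m m n≤o ⟩
  n ∸ m                  ≡⟨ m≤n⇒∣m-n∣≡n∸m m≤n ⟨
  ∣ m - n ∣              ∎
  where open ≡-Reasoning
... | inj₂ n≤m = begin
  ∣ (o ∸ m) - (o ∸ n) ∣  ≡⟨ m≤n⇒∣m-n∣≡n∸m (∸-monoʳ-≤ o n≤m) ⟩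
  (o ∸ n) ∸ (o ∸ m)      ≡⟨ [o∸m]∸[o∸n]≡n∸m n m≤o ⟩
  m ∸ n                  ≡⟨ m≤n⇒∣n-m∣≡n∸m n≤m ⟨
  ∣ m - n ∣              ∎
  where open ≡-Reasoning

m+n≤o+p⇒m∸o≤p∸n : ∀ {m n p} o → n ≤ p → m + n ≤ o + p → m ∸ o ≤ p ∸ n
m+n≤o+p⇒m∸o≤p∸n {m} {n} {p} o n≤p m+n≤o+p = m≤n+o⇒m∸n≤o m o (begin
  m              ≤⟨ m+n≤o⇒m≤o∸n m m+n≤o+p ⟩
  (o + p) ∸ n    ≡⟨ +-∸-assoc o n≤p ⟩
  o + (p ∸ n)    ∎)
  where open ≤-Reasoning

-- Two distinct vertices of the same layer are at distance 2.
span : ℕ → ℕ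
span zero    = 2
span (suc d) = suc d

span-∸ : ∀ {a b} → a < b → span ∣ a - b ∣ ≡ b ∸ a
span-∸ {a} {b} a<b = trans (cong span (m≤n⇒∣m-n∣≡n∸m (<⇒≤ a<b))) (span-positive (m<n⇒0<n∸m a<b))
  where
  span-positive : ∀ {d} → 0 < d → span d ≡ d
  span-positive {suc _} _ = refl

span-refl : ∀ {a b} → a ≡ b → span ∣ a - b ∣ ≡ 2
span-refl a≡b = cong span (m≡n⇒∣m-n∣≡0 a≡b)

module Congruence (Δ : ℕ) where
  infix 4 _≋_

  record _≋_ (a b : ℕ) : Set where
    constructor multiples
    field
      i j      : ℕ
      balanced : a + i * Δ ≡ b + j * Δ

  ≋-refl : ∀ {a} → a ≋ a
  ≋-refl = multiples 0 0 refl

  ≋-sym : ∀ {a b} → a ≋ b → b ≋ a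
  ≋-sym (multiples i j eq) = multiples j i (sym eq)

  ≋-+ : ∀ {a b c d} → a ≋ b → c ≋ d → a + c ≋ b + d
  ≋-+ {a} {b} {c} {d} (multiples i j p) (multiples i′ j′ q) = multiples (i + i′) (j + j′) (begin
    a + c + (i + i′) * Δ          ≡⟨ rearrange a c i i′ Δ ⟩
    (a + i * Δ) + (c + i′ * Δ)    ≡⟨ cong₂ _+_ p q ⟩
    (b + j * Δ) + (d + j′ * Δ)    ≡⟨ rearrange b d j j′ Δ ⟨
    b + d + (j + j′) * Δ          ∎)
    where
    open ≡-Reasoning
    rearrange : ∀ a c i i′ Δ → a + c + (i + i′) * Δ ≡ (a + i * Δ) + (c + i′ * Δ)
    rearrange = solve-∀

  ≋-cancel : ∀ {a b c d} → a ≋ b → a + c ≋ b + d → c ≋ d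
  ≋-cancel {a} {b} {c} {d} (multiples i j p) (multiples i′ j′ q) =
    multiples (i′ + j) (j′ + i) (+-cancelˡ-≡ (a + b) _ _ (begin
      a + b + (c + (i′ + j) * Δ)          ≡⟨ rearrange a b c i′ j Δ ⟩
      (a + c + i′ * Δ) + (b + j * Δ)      ≡⟨ cong₂ _+_ q (sym p) ⟩
      (b + d + j′ * Δ) + (a + i * Δ)      ≡⟨ rearrange b a d j′ i Δ ⟨
      b + a + (d + (j′ + i) * Δ)          ≡⟨ cong (_+ (d + (j′ + i) * Δ)) (+-comm b a) ⟩
      a + b + (d + (j′ + i) * Δ)          ∎))
    where
    open ≡-Reasoning
    rearrange : ∀ a b c i j Δ →
                a + b + (c + (i + j) * Δ) ≡ (a + c + i * Δ) + (b + j * Δ)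
    rearrange = solve-∀


  ≋⇒≡ : ∀ {a b} → a < Δ → b < Δ → a ≋ b → a ≡ b
  ≋⇒≡ {a} {b} a<Δ b<Δ (multiples i j eq) = begin
    a                ≡⟨ m<n⇒m%n≡m a<Δ ⟨
    a % Δ            ≡⟨ [m+kn]%n≡m%n a i Δ ⟨
    (a + i * Δ) % Δ  ≡⟨ cong (_% Δ) eq ⟩
    (b + j * Δ) % Δ  ≡⟨ [m+kn]%n≡m%n b j Δ ⟩
    b % Δ            ≡⟨ m<n⇒m%n≡m b<Δ ⟩
    b                ∎
    where
    open ≡-Reasoning
    instance
      Δ≢0 : NonZero Δ
      Δ≢0 = >-nonZero (≤-<-trans z≤n a<Δ)

  ≋-trans : ∀ {a b c} → a ≋ b → b ≋ c → a ≋ c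
  ≋-trans {a} {b} {c} p q =
    ≋-cancel ≋-refl (subst (_≋ b + c) (+-comm a b) (≋-+ p q))

module Schedule {Δ : ℕ} (G : Digraph) (lab : Labeling Δ G) where
  open Digraph G
  open Temporal G lab
  open Congruence Δ

  active-≋ : ∀ e {t} → ActiveAt e t → t ≋ toℕ (lab e)
  active-≋ _ (i , eq) = multiples 0 i (trans (+-identityʳ _) eq)

  simultaneous-≋ : ∀ e {s t} → ActiveAt e s → ActiveAt e t → s ≋ t
  simultaneous-≋ e {s} {t} p q = ≋-trans (active-≋ e p) (≋-sym (active-≋ e q))

  firstEdge : ∀ {u t v t′} → TemporalWalk u t v t′ →
              ∃[ w ] Σ[ e ∈ E u w ] ActiveAt (u , w , e) t
  firstEdge (last e act)     = _ , e , act
  firstEdge (step e act _ _) = _ , e , act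

  lastEdge : ∀ {u t v t′} → TemporalWalk u t v t′ →
             ∃[ w ] Σ[ e ∈ E w v ] ActiveAt (w , v , e) t′
  lastEdge (last e act)   = _ , e , act
  lastEdge (step _ _ _ w) = lastEdge w

  t₁≤tₗ : ∀ {u t v t′} → TemporalWalk u t v t′ → t ≤ t′
  t₁≤tₗ (last _ _)       = ≤-refl
  t₁≤tₗ (step _ _ t<t′ w) = ≤-trans (<⇒≤ t<t′) (t₁≤tₗ w)

  t₁<tₗ : ∀ {u t v t′} → ¬ E u v → TemporalWalk u t v t′ → t < t′
  t₁<tₗ ¬e (last e _)        = contradiction e ¬e
  t₁<tₗ ¬e (step _ _ t<t′ w) = <-≤-trans t<t′ (t₁≤tₗ w)

  forget : ∀ {u t v t′} (w : TemporalWalk u t v t′) →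
           Σ[ w′ ∈ Walk u v ] vertices w′ ≡ temporalVertices w × walkLength w′ + t ≤ suc t′
  forget (last e _) = e ◅ ε , refl , ≤-refl
  forget {u} {t} (step {t′ = t″} e _ t<t″ w) =
    let w′ , same , bound = forget w in
    e ◅ w′ , cong (u ∷_) same ,
    ≤-trans (≤-trans (≤-reflexive (sym (+-suc _ t))) (+-monoʳ-≤ (walkLength w′) t<t″)) bound

-- A presentation of a graph by layers 0, …, n in which only the extreme layers
-- may contain several vertices, and in which the vertices of consecutive layers
-- are adjacent.
record Layering (G : Digraph) (n : ℕ) : Set where
  open Digraph G
  field
    1<n    : 1 < n
    height : V → ℕ
    height≤n : ∀ v → height v ≤ n
    adjacent⇒ : ∀ {u v} → E u v → ∣ height u - height v ∣ ≡ 1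
    adjacent⇐ : ∀ {u v} → ∣ height u - height v ∣ ≡ 1 → E u v
    inner  : ∀ c → 0 < c → c < n → ∃[ v ] height v ≡ c
    inner-injective : ∀ {u v} → 0 < height u → height u < n → height u ≡ height v → u ≡ v

  up⊎down : ∀ {u v} → E u v → height v ≡ suc (height u) ⊎ height u ≡ suc (height v)
  up⊎down e = ∣m-n∣≡1⇒n≡1+m∨m≡1+n _ _ (adjacent⇒ e)

  up : ∀ {u v} → height v ≡ suc (height u) → E u v
  up {u} eq = adjacent⇐ (trans (cong ∣ height u -_∣ eq) (∣m-1+m∣≡1 (height u)))

  down : ∀ {u v} → height u ≡ suc (height v) → E u v
  down {u} {v} eq = adjacent⇐ (trans (∣-∣-comm (height u) _)
    (trans (cong ∣ height v -_∣ eq) (∣m-1+m∣≡1 (height v))))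

  lipschitz : ∀ {u v} → E u v → height v ≤ suc (height u)
  lipschitz e with up⊎down e
  ... | inj₁ eq = ≤-reflexive eq
  ... | inj₂ eq = m≤n⇒m≤1+n (≤-trans (n≤1+n _) (≤-reflexive (sym eq)))

  level-nonadjacent : ∀ {u v} → height u ≡ height v → ¬ E u v
  level-nonadjacent {u} hu≡hv e
    with trans (sym (m≡n⇒∣m-n∣≡0 hu≡hv)) (adjacent⇒ e)
  ... | ()

  from-bottom : ∀ {u v} → height u ≡ 0 → E u v → height v ≡ 1
  from-bottom {u} hu≡0 e with up⊎down e
  ... | inj₁ eq = trans eq (cong suc hu≡0)
  ... | inj₂ eq with trans (sym hu≡0) eq
  ...   | ()

flip : ∀ {G n} → Layering G n → Layering G n
flip {G} {n} L = record
  { 1<n = 1<n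
  ; height = λ v → n ∸ height v
  ; height≤n = λ v → m∸n≤m n (height v)
  ; adjacent⇒ = λ e → trans (reflect _ _) (adjacent⇒ e)
  ; adjacent⇐ = λ eq → adjacent⇐ (trans (sym (reflect _ _)) eq)
  ; inner = λ c 0<c c<n →
      let v , hv = inner (n ∸ c) (m<n⇒0<n∸m c<n) (∸-monoʳ-< 0<c (<⇒≤ c<n)) in
      v , trans (cong (n ∸_) hv) (m∸[m∸n]≡n (<⇒≤ c<n))
  ; inner-injective = λ {u} {v} 0<n∸hu n∸hu<n eq →
      inner-injective (∸-cancelʳ-< {o = n} n∸hu<n)
        (≰⇒> λ n≤hu → <⇒≢ 0<n∸hu (sym (m≤n⇒m∸n≡0 n≤hu)))
        (∸-cancelˡ-≡ (height≤n u) (height≤n v) eq)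
  }
  where
  open Layering L
  reflect : ∀ u v → ∣ (n ∸ height u) - (n ∸ height v) ∣ ≡ ∣ height u - height v ∣
  reflect u v = ∣o∸m-o∸n∣≡∣m-n∣ (height≤n u) (height≤n v)

module Statics {G : Digraph} {n : ℕ} (L : Layering G n) where
  open Digraph G
  open Layering L

  height≤length+height : ∀ {u v} (w : Walk u v) → height v ≤ walkLength w + height u
  height≤length+height ε = ≤-refl
  height≤length+height {u} {v} (_◅_ {j = j} e w) = begin
    height v                        ≤⟨ height≤length+height w ⟩
    walkLength w + height j         ≤⟨ +-monoʳ-≤ (walkLength w) (lipschitz e) ⟩
    walkLength w + suc (height u)   ≡⟨ +-suc _ _ ⟩
    suc (walkLength w + height u)   ∎
    where open ≤-Reasoning

  visits : ∀ {u v c} (w : Walk u v) → height u ≤ c → c ≤ height v →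
           Any (λ a → height a ≡ c) (vertices w)
  visits ε hu≤c c≤hv = here (≤-antisym hu≤c c≤hv)
  visits {u} {c = c} (e ◅ w) hu≤c c≤hv with height u ≟ c
  ... | yes hu≡c = here hu≡c
  ... | no  hu≢c = there (visits w (≤-trans (lipschitz e) (≤∧≢⇒< hu≤c hu≢c)) c≤hv)

  target∈vertices : ∀ {u v} (w : Walk u v) → Any (_≡ v) (vertices w)
  target∈vertices ε       = here refl
  target∈vertices (_ ◅ w) = there (target∈vertices w)

  source≢ : ∀ {u j v} (w : Walk j v) → All (u ≢_) (vertices w) → u ≢ j
  source≢ ε       (u≢j ∷ _) = u≢j
  source≢ (_ ◅ _) (u≢j ∷ _) = u≢j

  no-cycle : ∀ {u v} (p : Path u v) → 2 ≤ pathLength p → ¬ (height v ≡ suc (height u))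
  no-cycle record { walk = e ◅ ε } (s≤s ()) _
  no-cycle {u} {v} record { walk = _◅_ {j = j} e (_◅_ {j = j′} e′ w)
                          ; distinct = u∉ ∷ j∉ ∷ _ } _ hv≡1+hu
    with up⊎down e
  ... | inj₂ hu≡1+hj =
    let hu≢a , ha≡hu = All.lookupAny u∉
          (visits (e′ ◅ w) (≤-trans (n≤1+n _) (≤-reflexive (sym hu≡1+hj)))
                           (≤-trans (n≤1+n _) (≤-reflexive (sym hv≡1+hu))))
    in hu≢a (inner-injective (≤-trans (s≤s z≤n) (≤-reflexive (sym hu≡1+hj)))
               (≤-trans (≤-reflexive (sym hv≡1+hu)) (height≤n v)) (sym ha≡hu))
  ... | inj₁ hj≡1+hu = case-next (up⊎down e′)
    where
    j≢v : j ≢ v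
    j≢v j≡v = let j≢a , a≡v = All.lookupAny j∉ (target∈vertices w)
              in j≢a (trans j≡v (sym a≡v))
    hj≮n : ¬ (height j < n)
    hj≮n hj<n = j≢v (inner-injective (≤-trans (s≤s z≤n) (≤-reflexive (sym hj≡1+hu))) hj<n
                       (trans hj≡1+hu (sym hv≡1+hu)))
    hj≡n : height j ≡ n
    hj≡n = ≤-antisym (height≤n j) (≮⇒≥ hj≮n)
    1+hu≡n : suc (height u) ≡ n
    1+hu≡n = trans (sym hj≡1+hu) hj≡n
    case-next : ¬ (height j′ ≡ suc (height j) ⊎ height j ≡ suc (height j′))
    case-next (inj₁ eq) = hj≮n (≤-trans (≤-reflexive (sym eq)) (height≤n j′))
    case-next (inj₂ eq) =
      source≢ w (All.tail u∉)
        (inner-injective (≤-pred (≤-trans 1<n (≤-reflexive (sym 1+hu≡n))))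
          (≤-reflexive 1+hu≡n) (suc-injective (trans (sym hj≡1+hu) eq)))

  bottom-twins-distance : ∀ {u v} → height u ≡ 0 → height v ≡ 0 → u ≢ v → IsDistance u v 2
  bottom-twins-distance {u} {v} hu≡0 hv≡0 u≢v =
    (record { walk = up (trans hs≡1 (cong suc (sym hu≡0)))
                     ◅ down (trans hs≡1 (cong suc (sym hv≡0))) ◅ ε
            ; distinct = (u≢s ∷ u≢v ∷ []) ∷ (s≢v ∷ []) ∷ [] ∷ [] }
    , refl)
    , λ p → at-least-two (Path.walk p)
    where
    s = proj₁ (inner 1 (s≤s z≤n) 1<n)
    hs≡1 = proj₂ (inner 1 (s≤s z≤n) 1<n)
    u≢s : u ≢ s
    u≢s u≡s with trans (sym hu≡0) (trans (cong height u≡s) hs≡1)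
    ... | ()
    s≢v : s ≢ v
    s≢v s≡v with trans (sym hv≡0) (trans (cong height (sym s≡v)) hs≡1)
    ... | ()
    at-least-two : ∀ (w : Walk u v) → 2 ≤ walkLength w
    at-least-two ε           = contradiction refl u≢v
    at-least-two (e ◅ ε)     = contradiction e (level-nonadjacent (trans hu≡0 (sym hv≡0)))
    at-least-two (_ ◅ _ ◅ _) = s≤s (s≤s z≤n)

module Dynamics {G : Digraph} {n : ℕ} (L : Layering G n) {Δ : ℕ} (lab : Labeling Δ G) where
  open Digraph G
  open Layering L
  open Temporal G lab
  open Congruence Δ
  open Schedule G lab

  Within : ℕ → Set
  Within k = ∀ {u v} → u ≢ v →
    Σ[ p ∈ TemporalPath u v ] duration p ≤ span ∣ height u - height v ∣ + k

  rise : ∀ {u t v t′} → TemporalWalk u t v t′ → height v + t ≤ height u + suc t′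
  rise {u} {t} (last e _) =
    ≤-trans (+-monoˡ-≤ t (lipschitz e)) (≤-reflexive (sym (+-suc (height u) t)))
  rise {u} {t} {v} {t′} (step {v = j} {t′ = t″} e _ t<t″ w) = +-cancelˡ-≤ 1 _ _ (begin
    suc (height v + t)           ≡⟨ +-suc (height v) t ⟨
    height v + suc t             ≤⟨ +-monoʳ-≤ (height v) t<t″ ⟩
    height v + t″                ≤⟨ rise w ⟩
    height j + suc t′            ≤⟨ +-monoˡ-≤ (suc t′) (lipschitz e) ⟩
    suc (height u + suc t′)      ∎)
    where open ≤-Reasoning

  record Crossing (c : ℕ) (u : V) (t : ℕ) (v : V) (t′ : ℕ) : Set where
    field
      {a b}  : V
      edge   : E a b
      time   : ℕ
      active : ActiveAt (a , b , edge) time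
      height-a : height a ≡ c
      height-b : height b ≡ suc c
      before : c + t ≤ height u + time
      after  : height v + time ≤ suc c + t′

  crossing : ∀ {u t v t′} c → TemporalWalk u t v t′ →
             height u ≤ c → c < height v → Crossing c u t v t′
  crossing {u} {t} {v} c (last e act) hu≤c c<hv = record
    { edge = e ; active = act ; height-a = hu≡c ; height-b = hv≡1+c
    ; before = ≤-reflexive (cong (_+ t) (sym hu≡c))
    ; after = ≤-reflexive (cong (_+ t) hv≡1+c) }
    where
    hu≡c : height u ≡ c
    hu≡c = ≤-antisym hu≤c (≤-pred (≤-trans c<hv (lipschitz e)))
    hv≡1+c : height v ≡ suc c
    hv≡1+c = ≤-antisym (≤-trans (lipschitz e) (s≤s hu≤c)) c<hv
  crossing {u} {t} {v} {t′} c (step {v = j} {t′ = t″} e act t<t″ w) hu≤c c<hv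
    with height j ≤? c
  ... | yes hj≤c = record
    { edge = edge ; active = active ; height-a = height-a ; height-b = height-b
    ; after = after
    ; before = +-cancelˡ-≤ 1 _ _ (begin
        suc (c + t)               ≡⟨ +-suc c t ⟨
        c + suc t                 ≤⟨ +-monoʳ-≤ c t<t″ ⟩
        c + t″                    ≤⟨ before ⟩
        height j + time           ≤⟨ +-monoˡ-≤ time (lipschitz e) ⟩
        suc (height u + time)     ∎) }
    where
    open Crossing (crossing c w hj≤c c<hv)
    open ≤-Reasoning
  ... | no hj≰c = record
    { edge = e ; active = act ; height-a = hu≡c ; height-b = hj≡1+c
    ; before = ≤-reflexive (cong (_+ t) (sym hu≡c))
    ; after = +-cancelˡ-≤ 1 _ _ (begin
        suc (height v + t)        ≡⟨ +-suc (height v) t ⟨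
        height v + suc t          ≤⟨ +-monoʳ-≤ (height v) t<t″ ⟩
        height v + t″             ≤⟨ rise w ⟩
        height j + suc t′         ≡⟨ cong (_+ suc t′) hj≡1+c ⟩
        suc c + suc t′            ≡⟨ +-suc (suc c) t′ ⟩
        suc (suc c + t′)          ∎) }
    where
    open ≤-Reasoning
    hu≡c : height u ≡ c
    hu≡c = ≤-antisym hu≤c (≤-pred (≤-trans (≰⇒> hj≰c) (lipschitz e)))
    hj≡1+c : height j ≡ suc c
    hj≡1+c = ≤-antisym (≤-trans (lipschitz e) (s≤s hu≤c)) (≰⇒> hj≰c)

  punctual : ∀ {u t v t′ v₁ v₂ m} → height u ≡ 0 → height v ≡ n →
             TemporalWalk u t v t′ → suc t′ ≡ n + t → 0 < m → suc m < n →
             height v₁ ≡ m → height v₂ ≡ suc m →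
             (e : E v₁ v₂) → ActiveAt (v₁ , v₂ , e) (m + t)
  punctual {t = t} {v₁ = v₁} {v₂} {m} hu≡0 hv≡n w 1+t′≡n+t 0<m 1+m<n h₁ h₂ e
    with crossing m w (≤-trans (≤-reflexive hu≡0) z≤n)
                  (≤-trans (<⇒≤ 1+m<n) (≤-reflexive (sym hv≡n)))
  ... | record { a = a ; b = b ; edge = e′ ; time = τ ; active = active
               ; height-a = ha ; height-b = hb ; before = before ; after = after }
    with refl ← inner-injective {a} {v₁} (≤-trans 0<m (≤-reflexive (sym ha)))
                  (≤-trans (s≤s (≤-reflexive ha)) (<⇒≤ 1+m<n)) (trans ha (sym h₁))
       | refl ← inner-injective {b} {v₂} (≤-trans (s≤s z≤n) (≤-reflexive (sym hb)))
                  (≤-trans (s≤s (≤-reflexive hb)) 1+m<n) (trans hb (sym h₂))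
    with refl ← E-irr e e′ = subst (ActiveAt (a , b , e)) τ≡m+t active
    where
    open ≤-Reasoning
    τ≡m+t : τ ≡ m + t
    τ≡m+t = ≤-antisym
      (+-cancelˡ-≤ n _ _ (begin
        n + τ                ≡⟨ cong (_+ τ) hv≡n ⟨
        height _ + τ         ≤⟨ after ⟩
        suc m + _            ≡⟨ +-suc m _ ⟨
        m + suc _            ≡⟨ cong (m +_) 1+t′≡n+t ⟩
        m + (n + t)          ≡⟨ +-assoc m n t ⟨
        m + n + t            ≡⟨ cong (_+ t) (+-comm m n) ⟩
        n + m + t            ≡⟨ +-assoc n m t ⟩
        n + (m + t)          ∎))
      (≤-trans before (≤-reflexive (cong (_+ τ) hu≡0)))

  bottom-start-≋ : ∀ {u t v t′ s w s′} → height u ≡ 0 →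
                   TemporalWalk u t v t′ → TemporalWalk u s w s′ → t ≋ s
  bottom-start-≋ {u} hu≡0 p q with firstEdge p | firstEdge q
  ... | a , e , act | a′ , e′ , act′
    with refl ← inner-injective {a} {a′} (≤-reflexive (sym (from-bottom hu≡0 e)))
                  (≤-trans (s≤s (≤-reflexive (from-bottom hu≡0 e))) 1<n)
                  (trans (from-bottom hu≡0 e) (sym (from-bottom hu≡0 e′)))
    with refl ← E-irr e e′ = simultaneous-≋ (u , a , e) act act′

  to-bottom : ∀ {u v} → height v ≡ 0 → E u v → height u ≡ 1
  to-bottom {u} hv≡0 e = from-bottom hv≡0 (adjacent⇐ (trans (∣-∣-comm _ (height u)) (adjacent⇒ e)))

  bottom-end-≋ : ∀ {u t v t′ w s s′} → height v ≡ 0 →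
                 TemporalWalk u t v t′ → TemporalWalk w s v s′ → t′ ≋ s′
  bottom-end-≋ {v = v} hv≡0 p q with lastEdge p | lastEdge q
  ... | a , e , act | a′ , e′ , act′
    with refl ← inner-injective {a} {a′} (≤-reflexive (sym (to-bottom hv≡0 e)))
                  (≤-trans (s≤s (≤-reflexive (to-bottom hv≡0 e))) 1<n)
                  (trans (to-bottom hv≡0 e) (sym (to-bottom hv≡0 e′)))
    with refl ← E-irr e e′ = simultaneous-≋ (a , v , e) act act′

module Ascending {G : Digraph} {n : ℕ} (L : Layering G n) {Δ : ℕ} (n≤Δ : n ≤ Δ)
  (lab : Labeling Δ G)
  (lab-up : ∀ {u v} (e : Digraph.E G u v) →
            Layering.height L v ≡ suc (Layering.height L u) →
            toℕ (lab (u , v , e)) ≡ Layering.height L u)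
  (lab-down : ∀ {u v} (e : Digraph.E G u v) →
              Layering.height L u ≡ suc (Layering.height L v) →
              toℕ (lab (u , v , e)) ≡ n ∸ Layering.height L u)
  where
  open Digraph G
  open Layering L
  open Temporal G lab
  open Schedule G lab
  open Statics L
  open Dynamics L lab

  record Ascent (u v : V) : Set where
    field
      tₗ       : ℕ
      walk     : TemporalWalk u (height u) v tₗ
      arrival  : suc tₗ ≡ height v
      above    : All (λ a → height u ≤ height a) (temporalVertices walk)
      distinct : Unique (temporalVertices walk)

  lower⇒≢ : ∀ {u v} → height u < height v → u ≢ v
  lower⇒≢ hu<hv refl = <-irrefl refl hu<hv

  up-active : ∀ {u v} (e : E u v) → height v ≡ suc (height u) → ActiveAt (u , v , e) (height u)
  up-active e eq = 0 , sym (trans (+-identityʳ _) (lab-up e eq))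

  ascend : ∀ d {u v} → height v ≡ suc (d + height u) → Ascent u v
  ascend zero {u} {v} eq = record
    { walk = last (up eq) (up-active (up eq) eq)
    ; arrival = sym eq
    ; above = ≤-refl ∷ <⇒≤ hu<hv ∷ []
    ; distinct = (lower⇒≢ hu<hv ∷ []) ∷ [] ∷ [] }
    where
    hu<hv = ≤-reflexive (sym eq)
  ascend (suc d) {u} {v} eq = record
    { walk = step (up hj≡1+hu) (up-active _ hj≡1+hu) (≤-reflexive (sym hj≡1+hu)) walk
    ; arrival = arrival
    ; above = ≤-refl ∷ All.map <⇒≤ higher
    ; distinct = All.map lower⇒≢ higher ∷ distinct }
    where
    1+hu<n : suc (height u) < n
    1+hu<n = begin
      suc (suc (height u))         ≤⟨ s≤s (s≤s (m≤n+m (height u) d)) ⟩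
      suc (suc (d + height u))     ≡⟨ eq ⟨
      height v                     ≤⟨ height≤n v ⟩
      n                            ∎
      where open ≤-Reasoning
    j = proj₁ (inner (suc (height u)) (s≤s z≤n) 1+hu<n)
    hj≡1+hu = proj₂ (inner (suc (height u)) (s≤s z≤n) 1+hu<n)
    open Ascent (ascend d {j} {v} (trans eq (cong suc (trans (sym (+-suc d (height u)))
                                              (cong (d +_) (sym hj≡1+hu))))))
    higher : All (λ a → height u < height a) (temporalVertices walk)
    higher = All.map (≤-trans (≤-reflexive (sym hj≡1+hu))) above

  ascent : ∀ {u v} → height u < height v → Ascent u v
  ascent {u} hu<hv with m≤n⇒∃[o]m+o≡n hu<hv
  ... | d , eq = ascend d (trans (sym eq) (cong suc (+-comm (height u) d)))

  ascending-fastest : ∀ {u v} → height u < height v →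
    Σ[ p ∈ TemporalPath u v ] IsFastest p × duration p ≡ height v ∸ height u
  ascending-fastest {u} {v} hu<hv = p , fastest , duration-p
    where
    open Ascent (ascent hu<hv)
    p : TemporalPath u v
    p = record { walk = walk ; distinct = distinct }
    duration-p : duration p ≡ height v ∸ height u
    duration-p = cong (_∸ height u) (trans (+-comm tₗ 1) arrival)
    fastest : IsFastest p
    fastest q = ≤-trans (≤-reflexive duration-p)
      (m+n≤o+p⇒m∸o≤p∸n (height u)
        (≤-trans (t₁≤tₗ Q.walk) (m≤m+n _ 1))
        (≤-trans (rise Q.walk) (≤-reflexive (cong (height u +_) (sym (+-comm Q.tₗ 1))))))
      where module Q = TemporalPath q

  ascending-distance : ∀ {u v} → height u < height v → IsDistance u v (height v ∸ height u)
  ascending-distance {u} {v} hu<hv =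
    (path , ≤-antisym (m+n≤o⇒m≤o∸n _ (≤-trans short (≤-reflexive arrival))) (at-least path))
    , at-least
    where
    open Ascent (ascent hu<hv)
    static = forget walk
    short = proj₂ (proj₂ static)
    path : Path u v
    path = record { walk = proj₁ static
                  ; distinct = subst Unique (sym (proj₁ (proj₂ static))) distinct }
    at-least : ∀ (p : Path u v) → height v ∸ height u ≤ pathLength p
    at-least p = m≤n+o⇒m∸n≤o _ (height u)
      (≤-trans (height≤length+height w) (≤-reflexive (+-comm (walkLength w) _)))
      where w = Path.walk p

  bottom-twins-fastest : ∀ {u v} → height u ≡ 0 → height v ≡ 0 → u ≢ v →
    Σ[ p ∈ TemporalPath u v ] IsFastest p × duration p ≡ n
  bottom-twins-fastest {u} {v} hu≡0 hv≡0 u≢v = p , fastest , duration-p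
    where
    s = proj₁ (inner 1 (s≤s z≤n) 1<n)
    hs≡1 : height s ≡ 1
    hs≡1 = proj₂ (inner 1 (s≤s z≤n) 1<n)
    hs≡1+hu : height s ≡ suc (height u)
    hs≡1+hu = trans hs≡1 (cong suc (sym hu≡0))
    hs≡1+hv : height s ≡ suc (height v)
    hs≡1+hv = trans hs≡1 (cong suc (sym hv≡0))
    lab-return : ∀ {j} (e : E j v) → toℕ (lab (j , v , e)) ≡ n ∸ 1
    lab-return e = trans (lab-down e (trans (to-bottom hv≡0 e) (cong suc (sym hv≡0))))
                         (cong (n ∸_) (to-bottom hv≡0 e))
    p : TemporalPath u v
    p = record
      { t₁ = 0 ; tₗ = n ∸ 1
      ; walk = step (up hs≡1+hu)
                 (0 , sym (trans (+-identityʳ _) (trans (lab-up _ hs≡1+hu) hu≡0)))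
                 (m<n⇒0<n∸m 1<n)
                 (last (down hs≡1+hv) (0 , sym (trans (+-identityʳ _) (lab-return _))))
      ; distinct = (lower⇒≢ (≤-reflexive (sym hs≡1+hu)) ∷ u≢v ∷ [])
                 ∷ ((λ s≡v → lower⇒≢ (≤-reflexive (sym hs≡1+hv)) (sym s≡v)) ∷ []) ∷ [] ∷ [] }
    duration-p : duration p ≡ n
    duration-p = m∸n+n≡m (<⇒≤ 1<n)
    fastest : IsFastest p
    fastest q = bound (firstEdge Q.walk) (lastEdge Q.walk)
      where
      module Q = TemporalPath q
      bound : ∃[ w ] Σ[ e ∈ E u w ] ActiveAt (u , w , e) Q.t₁ →
              ∃[ w ] Σ[ e ∈ E w v ] ActiveAt (w , v , e) Q.tₗ →
              duration p ≤ duration q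
      bound (a , e , i , t₁≡) (b , e′ , j , tₗ≡) = begin
        n ∸ 1 + 1                   ≤⟨ m+n≤o⇒m≤o∸n (n ∸ 1 + 1) (begin
            n ∸ 1 + 1 + Q.t₁        ≡⟨ cong (n ∸ 1 + 1 +_) t₁≡iΔ ⟩
            n ∸ 1 + 1 + i * Δ       ≤⟨ +-monoʳ-≤ (n ∸ 1 + 1) (*-monoˡ-≤ Δ i≤j) ⟩
            n ∸ 1 + 1 + j * Δ       ≡⟨ rearrange (n ∸ 1) (j * Δ) ⟩
            n ∸ 1 + j * Δ + 1       ≡⟨ cong (_+ 1) tₗ≡n-1+jΔ ⟨
            Q.tₗ + 1                ∎) ⟩
        (Q.tₗ + 1) ∸ Q.t₁           ∎
        where
        open ≤-Reasoning
        rearrange : ∀ a b → a + 1 + b ≡ a + b + 1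
        rearrange = solve-∀
        t₁≡iΔ : Q.t₁ ≡ i * Δ
        t₁≡iΔ = trans t₁≡ (cong (_+ i * Δ)
          (trans (lab-up e (trans (from-bottom hu≡0 e) (cong suc (sym hu≡0)))) hu≡0))
        tₗ≡n-1+jΔ : Q.tₗ ≡ n ∸ 1 + j * Δ
        tₗ≡n-1+jΔ = trans tₗ≡ (cong (_+ j * Δ) (lab-return e′))
        i≤j : i ≤ j
        i≤j = ≮⇒≥ λ j<i → <⇒≱
          (t₁<tₗ (level-nonadjacent (trans hu≡0 (sym hv≡0))) Q.walk) (begin
            Q.tₗ             ≡⟨ tₗ≡n-1+jΔ ⟩
            n ∸ 1 + j * Δ    ≤⟨ +-monoˡ-≤ (j * Δ) (≤-trans (m∸n≤m n 1) n≤Δ) ⟩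
            Δ + j * Δ        ≤⟨ *-monoˡ-≤ Δ j<i ⟩
            i * Δ            ≡⟨ t₁≡iΔ ⟨
            Q.t₁             ∎)

module Canonical {G : Digraph} {n : ℕ} (L : Layering G n) {Δ : ℕ} (n≤Δ : n ≤ Δ) where
  open Digraph G
  open Layering L

  departure : V → V → ℕ
  departure u v with height u <? height v
  ... | yes _ = height u
  ... | no  _ = n ∸ height u

  departure-up : ∀ {u v} → height v ≡ suc (height u) → departure u v ≡ height u
  departure-up {u} {v} eq with height u <? height v
  ... | yes _   = refl
  ... | no  h≮h = contradiction (≤-reflexive (sym eq)) h≮h

  departure-down : ∀ {u v} → height u ≡ suc (height v) → departure u v ≡ n ∸ height u
  departure-down {u} {v} eq with height u <? height v
  ... | yes h<h = contradiction (≤-reflexive (sym eq)) (<⇒≯ h<h)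
  ... | no  _   = refl

  departure<n : ∀ {u v} → E u v → departure u v < n
  departure<n {u} {v} e with up⊎down e
  ... | inj₁ eq = ≤-trans (≤-reflexive (trans (cong suc (departure-up eq)) (sym eq))) (height≤n v)
  ... | inj₂ eq = ≤-<-trans (≤-reflexive (trans (departure-down eq) (cong (n ∸_) eq)))
                    (∸-monoʳ-< {n} (s≤s z≤n) (≤-trans (≤-reflexive (sym eq)) (height≤n u)))

  canonical : Labeling Δ G
  canonical (u , v , e) = fromℕ< (<-≤-trans (departure<n e) n≤Δ)

  canonical-up : ∀ {u v} (e : E u v) → height v ≡ suc (height u) →
                 toℕ (canonical (u , v , e)) ≡ height u
  canonical-up e eq = trans (toℕ-fromℕ< _) (departure-up eq)

  canonical-down : ∀ {u v} (e : E u v) → height u ≡ suc (height v) →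
                   toℕ (canonical (u , v , e)) ≡ n ∸ height u
  canonical-down e eq = trans (toℕ-fromℕ< _) (departure-down eq)

  flip-step : ∀ {u v} → n ∸ height v ≡ suc (n ∸ height u) → height u ≡ suc (height v)
  flip-step {u} {v} eq = ∸-cancelˡ-≡ {m = n} (height≤n u) hv<n (begin
    n ∸ height u               ≡⟨ cong pred eq ⟨
    pred (n ∸ height v)        ≡⟨ pred[m∸n]≡m∸[1+n] n (height v) ⟩
    n ∸ suc (height v)         ∎)
    where
    open ≡-Reasoning
    hv<n : height v < n
    hv<n = ≰⇒> λ n≤hv → 0≢1+n (trans (sym (m≤n⇒m∸n≡0 n≤hv)) eq)

  module Up = Ascending L n≤Δ canonical canonical-up canonical-down
  module Down = Ascending (flip L) n≤Δ canonical
    (λ e eq → canonical-down e (flip-step eq))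
    (λ {u} e eq → trans (canonical-up e (flip-step eq)) (sym (m∸[m∸n]≡n (height≤n u))))

excess : ∀ {k t t′} d → t + d ≤ t′ → t′ + 1 ∸ t ≤ suc d + k →
         ∃[ δ ] δ ≤ k × t′ ≡ t + d + δ
excess {k} {t} {t′} d t+d≤t′ short with m≤n⇒∃[o]m+o≡n t+d≤t′
... | δ , refl = δ , +-cancelˡ-≤ (suc d) _ _ (begin
    suc d + δ                  ≡⟨ m+n∸m≡n t (suc d + δ) ⟨
    t + (suc d + δ) ∸ t        ≡⟨ cong (_∸ t) (rearrange t d δ) ⟩
    t + d + δ + 1 ∸ t          ≤⟨ short ⟩
    suc d + k                  ∎) , refl
  where
  open ≤-Reasoning
  rearrange : ∀ t d δ → t + (suc d + δ) ≡ t + d + δ + 1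
  rearrange = solve-∀

module Balance {Δ k} (4k<Δ : 4 * k < Δ) where
  open Congruence Δ

  balance : ∀ {t s p q e e′ δ δ′} → e ≤ k → e′ ≤ k → δ ≤ k → δ′ ≤ k →
            t ≋ p → s ≋ q →
            t + 1 + e ≋ q + (1 + k) + δ′ → s + 1 + e′ ≋ p + (1 + k) + δ →
            δ ≡ 0 × δ′ ≡ 0 × p ≋ q
  balance {t} {s} {p} {q} {e} {e′} {δ} {δ′} e≤k e′≤k δ≤k δ′≤k t≋p s≋q y-end z-end =
    δ≡0 , m+n≡0⇒n≡0 δ δ+δ′≡0 , ≋-trans (≋-sym t≋p) t≋q
    where
    open ≤-Reasoning
    regroup₁ : ∀ t e s e′ → (t + 1 + e) + (s + 1 + e′) ≡ (t + s + 2) + (e + e′)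
    regroup₁ = solve-∀
    regroup₂ : ∀ q δ′ p δ k →
               (q + (1 + k) + δ′) + (p + (1 + k) + δ) ≡ (p + q + 2) + (k + k + (δ + δ′))
    regroup₂ = solve-∀
    4k : ∀ k → k + k + (k + k) ≡ 4 * k
    4k = solve-∀
    total-≋ : e + e′ ≋ k + k + (δ + δ′)
    total-≋ = ≋-cancel (≋-+ (≋-+ t≋p s≋q) ≋-refl)
      (subst₂ _≋_ (regroup₁ t e s e′) (regroup₂ q δ′ p δ k) (≋-+ y-end z-end))
    total : e + e′ ≡ k + k + (δ + δ′)
    total = ≋⇒≡
      (begin-strict
        e + e′               ≤⟨ +-mono-≤ e≤k e′≤k ⟩
        k + k                ≤⟨ m≤m+n (k + k) (k + k) ⟩
        k + k + (k + k)      ≡⟨ 4k k ⟩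
        4 * k                <⟨ 4k<Δ ⟩
        Δ                    ∎)
      (begin-strict
        k + k + (δ + δ′)     ≤⟨ +-monoʳ-≤ (k + k) (+-mono-≤ δ≤k δ′≤k) ⟩
        k + k + (k + k)      ≡⟨ 4k k ⟩
        4 * k                <⟨ 4k<Δ ⟩
        Δ                    ∎)
      total-≋
    δ+δ′≡0 : δ + δ′ ≡ 0
    δ+δ′≡0 = n≤0⇒n≡0 (+-cancelˡ-≤ (k + k) _ _ (begin
      k + k + (δ + δ′)       ≡⟨ total ⟨
      e + e′                 ≤⟨ +-mono-≤ e≤k e′≤k ⟩
      k + k                  ≡⟨ +-identityʳ (k + k) ⟨
      k + k + 0              ∎))
    δ≡0 : δ ≡ 0
    δ≡0 = m+n≡0⇒m≡0 δ δ+δ′≡0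
    e≡k : e ≡ k
    e≡k = ≤-antisym e≤k (+-cancelʳ-≤ k _ _ (begin
      k + k                  ≤⟨ m≤m+n (k + k) (δ + δ′) ⟩
      k + k + (δ + δ′)       ≡⟨ total ⟨
      e + e′                 ≤⟨ +-monoʳ-≤ e e′≤k ⟩
      e + k                  ∎))
    t≋q : t ≋ q
    t≋q = ≋-cancel {1 + k} ≋-refl (subst₂ _≋_
      (trans (cong (t + 1 +_) e≡k) (trans (+-assoc t 1 k) (+-comm t (1 + k))))
      (trans (cong (q + (1 + k) +_) (m+n≡0⇒n≡0 δ δ+δ′≡0))
             (trans (+-identityʳ _) (+-comm q (1 + k))))
      y-end)

module Forcing {G : Digraph} {k : ℕ} (L : Layering G (2 + k))
  {Δ : ℕ} (4k<Δ : 4 * k < Δ) (lab : Labeling Δ G)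
  (within : Dynamics.Within L lab k)
  where
  open Digraph G
  open Layering L
  open Temporal G lab
  open Congruence Δ
  open Schedule G lab
  module D↑ = Dynamics L lab
  module D↓ = Dynamics (flip L) lab

  twins-excess : ∀ {u v} → height u ≡ height v → u ≢ v →
    ∃[ t ] ∃[ e ] e ≤ k × TemporalWalk u t v (t + 1 + e)
  twins-excess hu≡hv u≢v with within u≢v
  ... | p , short
    with δ , δ≤k , refl ← excess 1
           (≤-trans (≤-reflexive (+-comm (TemporalPath.t₁ p) 1))
                    (t₁<tₗ (level-nonadjacent hu≡hv) (TemporalPath.walk p)))
           (≤-trans short (≤-reflexive (cong (_+ k) (span-refl hu≡hv))))
    = _ , δ , δ≤k , TemporalPath.walk p

  end-to-end-excess : ∀ {u v} → u ≢ v → span ∣ height u - height v ∣ ≡ 2 + k →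
    (∀ {t t′} → TemporalWalk u t v t′ → 2 + k + t ≤ suc t′) →
    ∃[ t ] ∃[ δ ] δ ≤ k × TemporalWalk u t v (t + (1 + k) + δ)
  end-to-end-excess u≢v d≡2+k slow with within u≢v
  ... | p , short
    with δ , δ≤k , refl ← excess (1 + k)
           (≤-trans (≤-reflexive (+-comm (TemporalPath.t₁ p) (1 + k)))
                    (≤-pred (slow (TemporalPath.walk p))))
           (≤-trans short (≤-reflexive (cong (_+ k) d≡2+k)))
    = _ , δ , δ≤k , TemporalPath.walk p

  flip-top : ∀ {v} → height v ≡ 2 + k → 2 + k ∸ height v ≡ 0
  flip-top hv = trans (cong (2 + k ∸_) hv) (n∸n≡0 k)

  flip-bottom : ∀ {v} → height v ≡ 0 → 2 + k ∸ height v ≡ 2 + k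
  flip-bottom hv = cong (2 + k ∸_) hv

  tight-forces : ∀ {x w y z v₁ v₂ p q δ δ′} m → 2 + k ≡ suc (m + m) → 0 < m →
    height x ≡ 0 → height y ≡ 0 → height w ≡ 2 + k → height z ≡ 2 + k →
    height v₁ ≡ m → height v₂ ≡ suc m → (e : E v₁ v₂) (e′ : E v₂ v₁) →
    TemporalWalk x p z (p + (1 + k) + δ) → TemporalWalk w q y (q + (1 + k) + δ′) →
    δ ≡ 0 × δ′ ≡ 0 × p ≋ q → lab (v₁ , v₂ , e) ≡ lab (v₂ , v₁ , e′)
  tight-forces {v₁ = v₁} {v₂} {p} {q} m n≡1+2m 0<m hx hy hw hz h₁ h₂ e e′ xz wy
    (refl , refl , p≋q) =
    toℕ-injective (≋⇒≡ (toℕ<n _) (toℕ<n _)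
      (≋-trans (≋-sym (active-≋ (v₁ , v₂ , e) active₁))
        (≋-trans (≋-+ {m} ≋-refl p≋q) (active-≋ (v₂ , v₁ , e′) active₂))))
    where
    tight : ∀ t → suc (t + (1 + k) + 0) ≡ 2 + k + t
    tight t = cong suc (trans (+-identityʳ _) (+-comm t (1 + k)))
    h₁↓ : 2 + k ∸ height v₁ ≡ suc m
    h₁↓ = trans (cong₂ _∸_ (trans n≡1+2m (sym (+-suc m m))) h₁) (m+n∸m≡n m (suc m))
    h₂↓ : 2 + k ∸ height v₂ ≡ m
    h₂↓ = trans (cong₂ _∸_ n≡1+2m h₂) (m+n∸m≡n m m)
    1+m<n : suc m < 2 + k
    1+m<n = ≤-trans (s≤s (+-monoˡ-≤ m 0<m)) (≤-reflexive (sym n≡1+2m))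
    active₁ : ActiveAt (v₁ , v₂ , e) (m + p)
    active₁ = D↑.punctual hx hz xz (tight p) 0<m 1+m<n h₁ h₂ e
    active₂ : ActiveAt (v₂ , v₁ , e′) (m + q)
    active₂ = D↓.punctual (flip-top hw) (flip-bottom hy) wy (tight q) 0<m 1+m<n h₂↓ h₁↓ e′

  forced : ∀ {x y w z v₁ v₂} m → 2 + k ≡ suc (m + m) → 0 < m →
    height x ≡ 0 → height y ≡ 0 → x ≢ y →
    height w ≡ 2 + k → height z ≡ 2 + k → w ≢ z →
    height v₁ ≡ m → height v₂ ≡ suc m →
    (e : E v₁ v₂) (e′ : E v₂ v₁) → lab (v₁ , v₂ , e) ≡ lab (v₂ , v₁ , e′)
  forced {x} {y} {w} {z} m n≡1+2m 0<m hx hy x≢y hw hz w≢z h₁ h₂ e e′ =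
    let t , _ , ≤k₁ , xy = twins-excess (trans hx (sym hy)) x≢y
        s , _ , ≤k₂ , wz = twins-excess (trans hw (sym hz)) w≢z
        p , _ , ≤k₃ , xz = end-to-end-excess {x} {z}
          (λ { refl → 0≢1+n (trans (sym hx) hz) })
          (cong₂ (λ a b → span ∣ a - b ∣) hx hz)
          (λ {t} {t′} p → subst₂ (λ a b → b + t ≤ a + suc t′) hx hz (D↑.rise p))
        q , _ , ≤k₄ , wy = end-to-end-excess {w} {y}
          (λ { refl → 0≢1+n (trans (sym hy) hw) })
          (cong₂ (λ a b → span ∣ a - b ∣) hw hy)
          (λ {t} {t′} p → subst₂ (λ a b → b + t ≤ a + suc t′)
            (flip-top hw) (flip-bottom hy) (D↓.rise p))
    in tight-forces m n≡1+2m 0<m hx hy hw hz h₁ h₂ e e′ xz wy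
         (Balance.balance 4k<Δ ≤k₁ ≤k₂ ≤k₃ ≤k₄
           (D↑.bottom-start-≋ hx xy xz) (D↓.bottom-start-≋ (flip-top hw) wz wy)
           (D↑.bottom-end-≋ hy xy wy) (D↓.bottom-end-≋ (flip-top hz) wz xz))

module Layered {G : Digraph} {k : ℕ} (L : Layering G (2 + k)) where
  open Digraph G
  open Layering L

  separation : V → V → ℕ
  separation u v = span ∣ height u - height v ∣

  module L↓ = Layering (flip L)

  separation-flip : ∀ u v → span ∣ L↓.height u - L↓.height v ∣ ≡ separation u v
  separation-flip u v = cong span (∣o∸m-o∸n∣≡∣m-n∣ (height≤n u) (height≤n v))

  data Placement (u v : V) : Set where
    ascending  : height u < height v → Placement u v
    descending : L↓.height u < L↓.height v → Placement u v
    bottom     : height u ≡ 0 → height v ≡ 0 → Placement u v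
    top        : L↓.height u ≡ 0 → L↓.height v ≡ 0 → Placement u v

  placement : ∀ {u v} → u ≢ v → Placement u v
  placement {u} {v} u≢v with <-cmp (height u) (height v)
  ... | tri< hu<hv _ _ = ascending hu<hv
  ... | tri> _ _ hv<hu = descending (∸-monoʳ-< hv<hu (height≤n u))
  ... | tri≈ _ hu≡hv _ with height u ≟ 0 | height u <? 2 + k
  ...   | yes hu≡0 | _        = bottom hu≡0 (trans (sym hu≡hv) hu≡0)
  ...   | no  hu≢0 | yes hu<n = contradiction (inner-injective (n≢0⇒n>0 hu≢0) hu<n hu≡hv) u≢v
  ...   | no  _    | no  hu≮n = top (m≤n⇒m∸n≡0 (≮⇒≥ hu≮n))
                                  (trans (cong (2 + k ∸_) (sym hu≡hv)) (m≤n⇒m∸n≡0 (≮⇒≥ hu≮n)))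

  distance : ∀ {u v} → u ≢ v → IsDistance u v (separation u v)
  distance {u} {v} u≢v with placement u≢v
  ... | ascending hu<hv = subst (IsDistance u v) (sym (span-∸ hu<hv)) (Up.ascending-distance hu<hv)
    where open Canonical L ≤-refl
  ... | descending hu<hv = subst (IsDistance u v)
          (trans (sym (span-∸ hu<hv)) (separation-flip u v)) (Down.ascending-distance hu<hv)
    where open Canonical L ≤-refl
  ... | bottom hu hv = subst (IsDistance u v) (sym (span-refl (trans hu (sym hv))))
                         (Statics.bottom-twins-distance L hu hv u≢v)
  ... | top hu hv = subst (IsDistance u v)
          (trans (sym (span-refl (trans hu (sym hv)))) (separation-flip u v))
          (Statics.bottom-twins-distance (flip L) hu hv u≢v)

  module _ {Δ : ℕ} (n≤Δ : 2 + k ≤ Δ) where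
    open Canonical L n≤Δ
    open Temporal G canonical

    canonical-within : ∀ {u v} → u ≢ v →
      Σ[ p ∈ TemporalPath u v ] IsFastest p × duration p ≤ separation u v + k
    canonical-within {u} {v} u≢v with placement u≢v
    ... | ascending hu<hv =
      let p , fastest , eq = Up.ascending-fastest hu<hv in
      p , fastest , ≤-trans (≤-reflexive (trans eq (sym (span-∸ hu<hv)))) (m≤m+n _ k)
    ... | descending hu<hv =
      let p , fastest , eq = Down.ascending-fastest hu<hv in
      p , fastest , ≤-trans (≤-reflexive (trans eq
        (trans (sym (span-∸ hu<hv)) (separation-flip u v)))) (m≤m+n _ k)
    ... | bottom hu hv =
      let p , fastest , eq = Up.bottom-twins-fastest hu hv u≢v in
      p , fastest , ≤-reflexive (trans eq (cong (_+ k) (sym (span-refl (trans hu (sym hv))))))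
    ... | top hu hv =
      let p , fastest , eq = Down.bottom-twins-fastest hu hv u≢v in
      p , fastest , ≤-reflexive (trans eq (cong (_+ k)
        (trans (sym (span-refl (trans hu (sym hv)))) (separation-flip u v))))

  no-cycle : ∀ {u v} (p : Path u v) → 2 ≤ pathLength p → ¬ E v u
  no-cycle p long e with up⊎down e
  ... | inj₂ eq = Statics.no-cycle L p long eq
  ... | inj₁ eq = Statics.no-cycle (flip L) p long (begin
      2 + k ∸ height _               ≡⟨ +-∸-assoc 1 {1 + k}
        (≤-pred (≤-trans (≤-reflexive (sym eq)) (height≤n _))) ⟩
      suc (1 + k ∸ height _)         ≡⟨ cong (λ h → suc (2 + k ∸ h)) eq ⟨
      suc (2 + k ∸ height _)         ∎)
    where open ≡-Reasoning

module Caterpillar (k : ℕ) where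
  n : ℕ
  n = 2 + k

  Vertex : Set
  Vertex = Fin (3 + n)

  -- Vertices 0, 1 share layer 0 and vertices n + 1, n + 2 share layer n.
  layer : Vertex → ℕ
  layer i = pred (toℕ i) ⊓ n

  graph : Graph
  graph = record
    { bidirected = record
      { V = Vertex
      ; finite = 3 + n , ↔-refl
      ; E = λ u v → ∣ layer u - layer v ∣ ≡ 1
      ; E? = λ u v → ∣ layer u - layer v ∣ ≟ 1
      ; E-irr = ≡-irrelevant }
    ; symmetric = λ {u} {v} → trans (∣-∣-comm (layer v) (layer u))
    ; irreflexive = λ { {u} refl e → 0≢1+n (trans (sym (∣n-n∣≡0 (layer u))) e) } }

  open Graph graph

  layer-inner : ∀ {i} → layer i < n → layer i ≡ pred (toℕ i)
  layer-inner {i} li<n with ≤-total (pred (toℕ i)) n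
  ... | inj₁ i≤n = m≤n⇒m⊓n≡m i≤n
  ... | inj₂ n≤i = contradiction (m≥n⇒m⊓n≡n n≤i) (<⇒≢ li<n)

  inner-vertex : ∀ c → c < n → ∃[ v ] layer v ≡ c
  inner-vertex c c<n = fromℕ< 1+c<3+n ,
    trans (cong (λ i → pred i ⊓ n) (toℕ-fromℕ< 1+c<3+n)) (m≤n⇒m⊓n≡m (<⇒≤ c<n))
    where
    1+c<3+n : suc c < 3 + n
    1+c<3+n = s≤s (≤-trans c<n (m≤n+m n 2))

  layering : Layering bidirected n
  layering = record
    { 1<n = s≤s (s≤s z≤n)
    ; height = layer
    ; height≤n = λ v → m⊓n≤n _ n
    ; adjacent⇒ = λ e → e
    ; adjacent⇐ = λ e → e
    ; inner = λ c _ → inner-vertex c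
    ; inner-injective = injective }
    where
    injective : ∀ {i j} → 0 < layer i → layer i < n → layer i ≡ layer j → i ≡ j
    injective {Fin.suc i} {Fin.suc j} _ li<n eq = cong Fin.suc (toℕ-injective (begin
      toℕ i               ≡⟨ layer-inner {Fin.suc i} li<n ⟨
      layer (Fin.suc i)   ≡⟨ eq ⟩
      layer (Fin.suc j)   ≡⟨ layer-inner {Fin.suc j} (subst (_< n) eq li<n) ⟩
      toℕ j               ∎))
      where open ≡-Reasoning
    injective {Fin.suc i} {Fin.zero} 0<li _ eq = contradiction (sym eq) (<⇒≢ 0<li)

  open Layered layering

  instance-of-DiTTR : TreeWithBounds
  instance-of-DiTTR = record
    { tree = graph
    ; isTree = record { connected = connected ; acyclic = no-cycle }
    ; D = λ u v → Supremum.[ separation u v + k ]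
    ; D-positive = λ u v → [ ≤-trans (span-positive ∣ layer u - layer v ∣) (m≤m+n _ k) ] }
    where
    connected : ∀ u v → Walk u v
    connected u v with u Fin.≟ v
    ... | yes refl = ε
    ... | no u≢v = Path.walk (proj₁ (proj₁ (distance u≢v)))
    span-positive : ∀ d → 1 ≤ span d
    span-positive zero    = s≤s z≤n
    span-positive (suc _) = s≤s z≤n

  w z : Vertex
  w = Fin.inject₁ (Fin.fromℕ (1 + n))
  z = Fin.fromℕ (2 + n)

  layer-w : layer w ≡ n
  layer-w = trans (cong (λ i → pred i ⊓ n) (trans (toℕ-inject₁ _) (toℕ-fromℕ (1 + n)))) (⊓-idem n)

  layer-z : layer z ≡ n
  layer-z = trans (cong (λ i → pred i ⊓ n) (toℕ-fromℕ (2 + n))) (m≥n⇒m⊓n≡n (n≤1+n n))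

  w≢z : w ≢ z
  w≢z = fromℕ≢inject₁ ∘ sym

  gadget : ∀ {Δ k′} → k′ ≤ k → ∃[ j ] k ≡ suc (j + j) → 4 * k < Δ →
           IsGadget Δ k′ instance-of-DiTTR
  gadget {Δ} k′≤k (j , k≡1+2j) 4k<Δ = record
    { hasSlack = λ u v u≢v → separation u v , distance u≢v , [ +-monoʳ-≤ (separation u v) k′≤k ]
    ; realizable = Canonical.canonical layering n≤Δ , λ u v u≢v →
        let p , fastest , short = canonical-within n≤Δ u≢v in p , fastest , [ short ]
    ; enforces = proj₁ v₁ , proj₁ v₂ , e , λ lab valid →
        Forcing.forced layering 4k<Δ lab
          (λ {u} {v} u≢v → let p , _ , short = valid u v u≢v in p , [≤]-injective short)
          {x = Fin.zero} {y = Fin.suc Fin.zero} {w} {z}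
          m n≡1+2m (s≤s z≤n) refl refl (λ ()) layer-w layer-z w≢z (proj₂ v₁) (proj₂ v₂)
          e (symmetric {proj₁ v₁} {proj₁ v₂} e) }
    where
    m = suc j
    n≡1+2m : n ≡ suc (m + m)
    n≡1+2m = trans (cong (2 +_) k≡1+2j) (cong (2 +_) (sym (+-suc j j)))
    1+m<n : suc m < n
    1+m<n = ≤-trans (s≤s (+-monoˡ-≤ m (s≤s z≤n))) (≤-reflexive (sym n≡1+2m))
    v₁ = inner-vertex m (<⇒≤ 1+m<n)
    v₂ = inner-vertex (suc m) 1+m<n
    e : E (proj₁ v₁) (proj₁ v₂)
    e = Layering.up layering {proj₁ v₁} {proj₁ v₂} (trans (proj₂ v₂) (cong suc (sym (proj₂ v₁))))
    1≤k : 1 ≤ k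
    1≤k = ≤-trans (s≤s z≤n) (≤-reflexive (sym k≡1+2j))
    n≤Δ : n ≤ Δ
    n≤Δ = ≤-trans (s≤s (≤-trans (+-monoˡ-≤ k 1≤k) (+-monoʳ-≤ k (m≤m+n k _)))) 4k<Δ

odd⇒1+2j : ∀ {k} → 2 ∤ k → ∃[ j ] k ≡ suc (j + j)
odd⇒1+2j {k} 2∤k = k / 2 , (begin
  k                        ≡⟨ m≡m%n+[m/n]*n k 2 ⟩
  k % 2 + k / 2 * 2        ≡⟨ cong (_+ k / 2 * 2) k%2≡1 ⟩
  1 + k / 2 * 2            ≡⟨ double (k / 2) ⟩
  suc (k / 2 + k / 2)      ∎)
  where
  open ≡-Reasoning
  double : ∀ j → 1 + j * 2 ≡ suc (j + j)
  double = solve-∀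
  k%2≡1 : k % 2 ≡ 1
  k%2≡1 = ≤-antisym (≤-pred (m%n<n k 2)) (n≢0⇒n>0 (2∤k ∘ m%n≡0⇒n∣m k 2))

lemma15 : Σ[ G ∈ (ℕ → ℕ → TreeWithBounds) ]
    ((∀ Δ k → 1 ≤ k → 2 ∤ k → 4 * k + 1 ≤ Δ → IsGadget Δ k (G Δ k)) ×
    (∀ Δ k → 2 ∣ k → 4 * k + 5 ≤ Δ → IsGadget Δ k (G Δ (k + 1))))
lemma15 =
  (λ _ k → Caterpillar.instance-of-DiTTR k)
  , (λ Δ k _ 2∤k 4k+1≤Δ →
      Caterpillar.gadget k ≤-refl (odd⇒1+2j 2∤k)
        (≤-trans (≤-reflexive (+-comm 1 (4 * k))) 4k+1≤Δ))
  , (λ Δ k 2∣k 4k+5≤Δ →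
      Caterpillar.gadget (k + 1) (m≤m+n k 1)
        (odd⇒1+2j λ 2∣k+1 → contradiction (∣1⇒≡1 (∣m+n∣m⇒∣n 2∣k+1 2∣k)) λ ())
        (≤-trans (≤-reflexive (regroup k)) 4k+5≤Δ))
  where
  regroup : ∀ k → suc (4 * (k + 1)) ≡ 4 * k + 5
  regroup = solve-∀
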